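{- For any integer $b\geq 2$ and any $n\geq b^2+b$, there are exactly $b^2$ smooth arithmetical structures on $D_n$ with $\bar r_y=b$.
   Context: For $n\ge 3$ let $\ell=n-3$. The bident $D_n$ has vertices $v_x,v_y,v_0,\dots,v_\ell$ and edges $v_xv_0$, $v_yv_0$, $v_iv_{i+1}$ ($0\le i\le\ell-1$). An arithmetical structure on $D_n$ is a pair $(\mathbf d,\mathbf r)$, $\mathbf d=(d_x,d_y,d_0,\dots,d_\ell)$, $\mathbf r=(r_x,r_y,r_0,\dots,r_\ell)$, of positive integer vectors with $(\operatorname{diag}(\mathbf d)-A)\mathbf r=\mathbf 0$ ($A$ the adjacency matrix) and $\mathbf r$ primitive. It is smooth if $d_x,d_y,d_1,\dots,d_\ell\ge2$. For such a structure, $\bar{\mathbf r}=\frac{r_0}{r_xr_y}\mathbf r$. -}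

module Defs where

open import Data.Nat using (ℕ; zero; suc; _+_; _*_; _≤_)
open import Data.Nat.Divisibility using (_∣_)
open import Data.Fin using (Fin; toℕ)
open import Data.Vec using (Vec; []; _∷_; lookup; tabulate; zipWith; sum)
open import Data.Product using (_×_; _,_; Σ)
open import Data.List using (List; length)
open import Data.List.Relation.Unary.All using (All)
open import Data.List.Relation.Unary.Unique.Propositional using (Unique)
open import Data.List.Membership.Propositional using (_∈_)
open import Relation.Binary.PropositionalEquality using (_≡_; _≢_)

-- Vertex numbering of the bident D_n (n ≥ 3, ℓ = n - 3):
--   index 0 = v_x, index 1 = v_y, index (2 + i) = v_i  (0 ≤ i ≤ ℓ).

pathAdj : ℕ → ℕ → ℕ
pathAdj zero (suc zero) = 1
pathAdj (suc zero) zero = 1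
pathAdj (suc a) (suc c) = pathAdj a c
pathAdj _ _ = 0

bidentAdj : ℕ → ℕ → ℕ
bidentAdj 0 2 = 1
bidentAdj 1 2 = 1
bidentAdj 2 0 = 1
bidentAdj 2 1 = 1
bidentAdj (suc (suc a)) (suc (suc c)) = pathAdj a c
bidentAdj _ _ = 0

A : (n : ℕ) → Fin n → Fin n → ℕ
A n i j = bidentAdj (toℕ i) (toℕ j)

Ar : (n : ℕ) → Vec ℕ n → Fin n → ℕ
Ar n r i = sum (zipWith _*_ (tabulate (A n i)) r)

Primitive : (n : ℕ) → Vec ℕ n → Set
Primitive n r = ∀ k → (∀ i → k ∣ lookup r i) → k ≡ 1

IsArithmetical : (n : ℕ) → Vec ℕ n × Vec ℕ n → Set
IsArithmetical n (d , r) =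
  (∀ i → 1 ≤ lookup d i) × (∀ i → 1 ≤ lookup r i) ×
  (∀ i → lookup d i * lookup r i ≡ Ar n r i) × Primitive n r

-- smooth: d_x, d_y, d_1, ..., d_ℓ ≥ 2 (every vertex except v_0, which has index 2)
IsSmooth : (n : ℕ) → Vec ℕ n × Vec ℕ n → Set
IsSmooth n (d , r) = ∀ i → toℕ i ≢ 2 → 2 ≤ lookup d i

-- entry of a vector at a natural-number index (0 if out of range; only used
-- at indices 0, 1, 2, which exist since n ≥ 3)
at : ∀ {n} → Vec ℕ n → ℕ → ℕ
at [] _ = 0
at (x ∷ xs) zero = x
at (x ∷ xs) (suc k) = at xs k

-- r̄_y = (r_0 / (r_x r_y)) · r_y = b, cleared of denominators:
-- r_0 · r_y = b · (r_x · r_y)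
RBarYEq : (n : ℕ) → Vec ℕ n × Vec ℕ n → ℕ → Set
RBarYEq n (d , r) b = at r 2 * at r 1 ≡ b * (at r 0 * at r 1)

Counted : (n b : ℕ) → Vec ℕ n × Vec ℕ n → Set
Counted n b s = IsArithmetical n s × IsSmooth n s × RBarYEq n s b

ExactlyCounted : (n b k : ℕ) → Set
ExactlyCounted n b k =
  Σ (List (Vec ℕ n × Vec ℕ n)) λ L →
    length L ≡ k × Unique L × All (Counted n b) L ×
    (∀ s → Counted n b s → s ∈ L)

{-# OPTIONS --safe #-}
module Submission where

-- The condition r̄_y = b says d_x = b, and smoothness forces d₀ = 1, so with a = d_y one has
-- r₁ / r₀ = (ab − a − b) / ab. The remaining entries of d and r are then forced: d₁, …, d_ℓ are the
-- Hirzebruch–Jung continued fraction of r₀ / r₁, and the only condition on a is that it has length ℓ.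
-- Writing a + b = (m + 1) b² + j with 1 ≤ j ≤ b², the sequence r runs, up to scaling, through the
-- arithmetic progression ab, ab − (a + b), … with b − 2 steps down to 2 (a + b) − b², then through
-- (a + b) − b², (a + b) − 2b², …, j, and ends like the sequence starting with b² + j, j. Its length is
-- therefore (b − 2) + m + h(j), where h(j) < b². Hence for ℓ ≥ b² + b − 3 each j admits exactly one m,
-- whereas a + b ≤ b² gives sequences that are too short.

open import Defs
open import Data.Nat using (ℕ; zero; suc; _+_; _*_; _∸_; _≤_; _<_; z≤n; s≤s; NonZero; >-nonZero; _≤?_)
open import Data.Nat.Properties
open import Data.Nat.Divisibility
open import Data.Nat.DivMod using (_/_; _%_; m≡m%n+[m/n]*n; m%n<n; [m+kn]%n≡m%n; m<n⇒m%n≡m)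
open import Data.Nat.GCD using (gcd; gcd[m,n]∣m; gcd[m,n]∣n; gcd-greatest; c*gcd[m,n]≡gcd[cm,cn])
open import Data.Nat.Induction using (<-rec)
open import Data.Nat.Tactic.RingSolver using (solve-∀)
open import Data.Fin using (Fin; zero; suc; toℕ; fromℕ<)
open import Data.Fin.Properties using (toℕ<n; toℕ-fromℕ<; toℕ-injective)
open import Data.Vec using (Vec; []; _∷_; lookup; map; tail; zipWith; sum; tabulate; foldr′)
open import Data.Vec.Properties using (lookup-map; map-∘; map-cong)
open import Data.List as List using (allFin)
open import Data.List.Properties using (length-map; length-tabulate)
open import Data.List.Membership.Propositional using (_∈_)
open import Data.List.Membership.Propositional.Properties using (∈-map⁺; ∈-allFin)
import Data.List.Relation.Unary.All.Properties as All
import Data.List.Relation.Unary.All as All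
import Data.List.Relation.Unary.Unique.Propositional.Properties as Unique
open import Data.Product using (Σ; ∃; ∃₂; _×_; _,_; proj₁; proj₂)
open import Data.Empty using (⊥; ⊥-elim)
open import Function using (id)
open import Relation.Nullary using (yes; no; contradiction)
open import Relation.Binary.PropositionalEquality using (_≡_; _≢_; refl; sym; trans; cong; cong₂; subst)
open import Relation.Binary.PropositionalEquality using (module ≡-Reasoning)

-- Chains and Hirzebruch-Jung continued fractions

-- Chain p q ds rs: rs = q, r₂, …, r_l is the sequence d_i r_i = r_{i-1} + r_{i+1} with r₀ = p, r_{l+1} = 0.
data Chain : (p q : ℕ) {l : ℕ} (ds rs : Vec ℕ l) → Set where
  end  : ∀ {p} → 1 ≤ p → Chain p 0 [] []
  step : ∀ {p q s l d} {ds rs : Vec ℕ l} → 2 ≤ d → d * q ≡ p + s →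
         Chain q s ds rs → Chain p q (d ∷ ds) (q ∷ rs)

HasLength : (p q l : ℕ) → Set
HasLength p q l = ∃₂ λ (ds rs : Vec ℕ l) → Chain p q ds rs

-- Induction from the far end: `s < q` and `2 ≤ d` give `q + s < d * q = p + s`. So a chain is
-- strictly decreasing.
chain-< : ∀ {p q l} {ds rs : Vec ℕ l} → Chain p q ds rs → q < p
chain-< (end 1≤p) = 1≤p
chain-< {p} {q} (step {s = s} {d = d} 2≤d eq ch) = +-cancelʳ-< s q p (begin-strict
  q + s  <⟨ +-monoʳ-< q (chain-< ch) ⟩
  q + q  ≡⟨ cong (q +_) (+-identityʳ q) ⟨
  2 * q  ≤⟨ *-monoˡ-≤ q 2≤d ⟩
  d * q  ≡⟨ eq ⟩
  p + s  ∎)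
  where open ≤-Reasoning

-- The bound `s < q` makes `d` the least multiplier with `p ≤ d * q`, that is the ceiling of
-- `p / q`; `d′` is another such multiplier.
ceiling-quotient-≤ : ∀ {p q s s′} d d′ → s < q → d * q ≡ p + s → d′ * q ≡ p + s′ → d ≤ d′
ceiling-quotient-≤ {p} {q} {s} {s′} d d′ s<q eq eq′ = ≮⇒≥ λ d′<d → n≮n (p + s) (begin-strict
  p + s       <⟨ +-monoʳ-< p s<q ⟩
  p + q       ≤⟨ +-monoˡ-≤ q (m≤m+n p s′) ⟩
  p + s′ + q  ≡⟨ cong (_+ q) eq′ ⟨
  d′ * q + q  ≡⟨ +-comm (d′ * q) q ⟩
  suc d′ * q  ≤⟨ *-monoˡ-≤ q d′<d ⟩
  d * q       ≡⟨ eq ⟩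
  p + s       ∎)
  where open ≤-Reasoning

-- Since chains decrease, each `d` is the ceiling of `p / q`, which also fixes `s`. The equality
-- lives in a Σ-type because the equality of the lengths is part of the conclusion.
chain-unique : ∀ {p q l l′} {ds rs : Vec ℕ l} {ds′ rs′ : Vec ℕ l′} →
  Chain p q ds rs → Chain p q ds′ rs′ →
  _≡_ {A = Σ ℕ λ l → Vec ℕ l × Vec ℕ l} (l , ds , rs) (l′ , ds′ , rs′)
chain-unique (end _) (end _) = refl
chain-unique (end _) (step _ _ ch) with () ← chain-< ch
chain-unique (step _ _ ch) (end _) with () ← chain-< ch
chain-unique {p} (step {d = d} _ eq ch) (step {d = d′} _ eq′ ch′)
  with refl ← ≤-antisym (ceiling-quotient-≤ d d′ (chain-< ch) eq eq′) (ceiling-quotient-≤ d′ d (chain-< ch′) eq′ eq)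
  with refl ← +-cancelˡ-≡ p _ _ (trans (sym eq) eq′)
  with refl ← chain-unique ch ch′ = refl

chain-cong : ∀ {p p′ q q′ l} {ds rs : Vec ℕ l} → p ≡ p′ → q ≡ q′ → Chain p q ds rs → Chain p′ q′ ds rs
chain-cong refl refl ch = ch

length-cong : ∀ {p p′ q q′ l} → p ≡ p′ → q ≡ q′ → HasLength p q l → HasLength p′ q′ l
length-cong p≡p′ q≡q′ (ds , rs , ch) = ds , rs , chain-cong p≡p′ q≡q′ ch

length-unique : ∀ {p q l l′} → HasLength p q l → HasLength p q l′ → l ≡ l′
length-unique (_ , _ , ch) (_ , _ , ch′) = cong proj₁ (chain-unique ch ch′)

chain-scale : ∀ k {p q l} {ds rs : Vec ℕ l} → 1 ≤ k →
  Chain p q ds rs → Chain (k * p) (k * q) ds (map (k *_) rs)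
chain-scale k 1≤k (end {p} 1≤p) =
  subst (λ z → Chain (k * p) z [] []) (sym (*-zeroʳ k)) (end (*-mono-≤ 1≤k 1≤p))
chain-scale k 1≤k (step {p} {q} {s} {d = d} 2≤d eq ch) = step 2≤d eq′ (chain-scale k 1≤k ch)
  where
  open ≡-Reasoning
  swap : ∀ d k q → d * (k * q) ≡ k * (d * q)
  swap = solve-∀
  eq′ : d * (k * q) ≡ k * p + k * s
  eq′ = begin
    d * (k * q)    ≡⟨ swap d k q ⟩
    k * (d * q)    ≡⟨ cong (k *_) eq ⟩
    k * (p + s)    ≡⟨ *-distribˡ-+ k p s ⟩
    k * p + k * s  ∎

ceiling-division : ∀ p q → 1 ≤ q → ∃₂ λ d s → d * q ≡ p + s × s < q
ceiling-division zero q 1≤q = 0 , 0 , refl , 1≤q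
ceiling-division (suc p) q 1≤q with ceiling-division p q 1≤q
... | d , suc s , eq , s<q = d , s , trans eq (+-suc p s) , <-trans (n<1+n s) s<q
-- The remainder is used up, so the quotient grows by one and the new remainder is the divisor minus
-- one.
ceiling-division (suc p) (suc q) 1≤q | d , zero , eq , s<q =
  suc d , q , trans (cong (suc q +_) (trans eq (+-identityʳ p))) (cong suc (+-comm q p)) , n<1+n q

-- Ceiling division replaces `q` by some `s < q`; hence the recursion terminates, and the length is
-- at most `q`.
chain-exists : ∀ q p → q < p → ∃ λ l → l ≤ q × HasLength p q l
chain-exists = <-rec (λ q → ∀ p → q < p → ∃ λ l → l ≤ q × HasLength p q l) go
  where
  go : ∀ q → (∀ {s} → s < q → ∀ p → s < p → ∃ λ l → l ≤ s × HasLength p s l) →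
       ∀ p → q < p → ∃ λ l → l ≤ q × HasLength p q l
  go zero rec p 0<p = 0 , z≤n , [] , [] , end 0<p
  go (suc q) rec p q<p with ceiling-division p (suc q) (s≤s z≤n)
  ... | d , s , eq , s<q with rec s<q (suc q) s<q
  ... | l , l≤s , ds , rs , ch = suc l , ≤-trans (s≤s l≤s) s<q , d ∷ ds , suc q ∷ rs , step 1<d eq ch
    where
    open ≤-Reasoning
    1<d : 1 < d
    1<d = *-cancelʳ-< (suc q) 1 d (begin-strict
      1 * suc q  ≡⟨ *-identityˡ (suc q) ⟩
      suc q      <⟨ q<p ⟩
      p          ≤⟨ m≤m+n p s ⟩
      p + s      ≡⟨ eq ⟨
      d * suc q  ∎)

-- An entry 2 in `ds` means that three consecutive terms are in arithmetic progression, so terms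
-- with the same difference `δ` can be put in front.
prepend-progression : ∀ {y δ l} k → HasLength (y + δ) y l → HasLength (y + suc k * δ) (y + k * δ) (k + l)
prepend-progression {y} {δ} zero ch =
  length-cong (cong (y +_) (sym (+-identityʳ δ))) (sym (+-identityʳ y)) ch
prepend-progression {y} {δ} (suc k) ch with prepend-progression k ch
... | ds , rs , ch′ = 2 ∷ ds , y + suc k * δ ∷ rs , step ≤-refl (identity y δ k) ch′
  where
  identity : ∀ y δ k → 2 * (y + suc k * δ) ≡ y + suc (suc k) * δ + (y + k * δ)
  identity = solve-∀

-- Raising the first `d` by one adds `q` to `p`. This is how the common difference changes between
-- two progressions.
increase-head : ∀ {p q l} → 1 ≤ q → HasLength p q l → HasLength (q + p) q l
increase-head 1≤q (_ , _ , step {p} {q} {s} {d = d} {ds} {rs} 2≤d eq ch) =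
  suc d ∷ ds , q ∷ rs , step (m≤n⇒m≤1+n 2≤d) (trans (cong (q +_) eq) (sym (+-assoc q p s))) ch

-- Lengths of the chains starting with a * b , a * b - (a + b)

-- The chain is built from its small end. Below, `m` steps of size `b * b` reach the pair `N`, `y`
-- with `N = a + b` and `y + b * b = N`; then `c = b - 2` steps of size `N` reach `a * b`, because
-- `a * b + b * b = N * b`.
long-chain : ∀ {b c a i m h Q} → b ≡ 2 + c → a + b ≡ suc i + suc m * (b * b) → Q + (a + b) ≡ a * b →
  HasLength (suc i + b * b) (suc i) h → HasLength (a * b) Q (c + (m + h))
long-chain {b} {c} {a} {i} {m} {h} {Q} b≡ eqN eqQ ch =
  length-cong p-eq q-eq (prepend-progression c
    (increase-head (s≤s z≤n) (prepend-progression m ch)))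
  where
  open ≡-Reasoning
  N y : ℕ
  N = suc i + suc m * (b * b)
  y = suc i + m * (b * b)
  identity : ∀ i m c → suc i + m * ((2 + c) * (2 + c)) + suc c * (suc i + suc m * ((2 + c) * (2 + c)))
    + (2 + c) * (2 + c) ≡ (suc i + suc m * ((2 + c) * (2 + c))) * (2 + c)
  identity = solve-∀
  regroup : ∀ i m {b c} → b ≡ 2 + c →
    suc i + m * (b * b) + suc c * (suc i + suc m * (b * b)) + b * b ≡ (suc i + suc m * (b * b)) * b
  regroup i m {c = c} refl = identity i m c
  p-eq : y + suc c * N ≡ a * b
  p-eq = +-cancelʳ-≡ (b * b) _ _ (begin
    y + suc c * N + b * b  ≡⟨ regroup i m b≡ ⟩
    N * b                  ≡⟨ cong (_* b) eqN ⟨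
    (a + b) * b            ≡⟨ *-distribʳ-+ b a b ⟩
    a * b + b * b          ∎)
  q-eq : y + c * N ≡ Q
  q-eq = +-cancelʳ-≡ N _ _ (begin
    y + c * N + N    ≡⟨ trans (+-assoc y _ N) (cong (y +_) (+-comm (c * N) N)) ⟩
    y + suc c * N    ≡⟨ p-eq ⟩
    a * b            ≡⟨ eqQ ⟨
    Q + (a + b)      ≡⟨ cong (Q +_) eqN ⟩
    Q + N            ∎)

-- The general bound gives `h ≤ suc (toℕ i)`, which is below `B` except when `suc (toℕ i) = B`;
-- there the chain starts with `2 * B`, `B` and has length 1.
residue-chain : ∀ B (i : Fin B) → 2 ≤ B → ∃ λ h → h < B × HasLength (suc (toℕ i) + B) (suc (toℕ i)) h
residue-chain B i 2≤B with suc (toℕ i) ≤? (B ∸ 1)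
... | yes i<B-1 with chain-exists (suc (toℕ i)) (suc (toℕ i) + B) (m<m+n _ (<-trans (s≤s z≤n) 2≤B))
...   | h , h≤ , ch = h , ≤-trans (s≤s (≤-trans h≤ i<B-1)) (≤-reflexive (m+[n∸m]≡n (<⇒≤ 2≤B))) , ch
residue-chain B i 2≤B | no i≮B-1 = 1 , 2≤B , 2 ∷ [] , _ ∷ [] , step ≤-refl eq (end (s≤s z≤n))
  where
  last : suc (toℕ i) ≡ B
  last = ≤-antisym (toℕ<n i) (≤-trans (≤-reflexive (sym (m+[n∸m]≡n (<⇒≤ 2≤B)))) (≰⇒> i≮B-1))
  double : ∀ x → 2 * x ≡ x + x + 0
  double = solve-∀
  eq : 2 * suc (toℕ i) ≡ suc (toℕ i) + B + 0
  eq = trans (double (suc (toℕ i))) (cong (λ z → suc (toℕ i) + z + 0) last)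

-- Dividing `a * b` by `N = a + b` with remainder `s` shows the shape of the chain: a progression
-- with difference `N` down to `s + N`, `s`, then at most `s` terms.
short-chain : ∀ {b c a Q l} → b ≡ 2 + c → 2 ≤ a → a + b ≤ b * b → b * b + b ≤ 3 + l →
  Q + (a + b) ≡ a * b → HasLength (a * b) Q l → ⊥
short-chain {b} {c} {a} {Q} {l} b≡ 2≤a N≤B bound eqQ hl = split ((a * b) / N) (m≡m%n+[m/n]*n (a * b) N)
  where
  N s : ℕ
  N = a + b
  instance
    N≢0 : NonZero N
    N≢0 = >-nonZero (≤-trans (<⇒≤ 2≤a) (m≤m+n a b))
  s = (a * b) % N
  s<N : s < N
  s<N = m%n<n (a * b) N
  open ≤-Reasoning
  -- The quotient suc k of a * b by N is at most b - 1, and s = 0 when equality holds, so k + s < l.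
  bound-length : ∀ k → a * b ≡ s + suc k * N → l ≤ k + s
  bound-length k eq with chain-exists s (s + N) (m<m+n s (≤-trans (<⇒≤ 2≤a) (m≤m+n a b)))
  ... | h , h≤s , ch = begin
    l      ≡⟨ length-unique hl (length-cong (sym eq) q-eq (prepend-progression k ch)) ⟩
    k + h  ≤⟨ +-monoʳ-≤ k h≤s ⟩
    k + s  ∎
    where
    q-eq : s + k * N ≡ Q
    q-eq = +-cancelʳ-≡ N _ _ (trans (trans (+-assoc s _ N) (cong (s +_) (+-comm (k * N) N)))
                                    (trans (sym eq) (sym eqQ)))
  bound′ : b * b + c ≤ 1 + l
  bound′ = +-cancelʳ-≤ 2 _ _ (begin
    b * b + c + 2    ≡⟨ +-assoc (b * b) c 2 ⟩
    b * b + (c + 2)  ≡⟨ cong (b * b +_) (trans (+-comm c 2) (sym b≡)) ⟩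
    b * b + b        ≤⟨ bound ⟩
    3 + l            ≡⟨ +-comm 2 (1 + l) ⟩
    1 + l + 2        ∎)
  split : ∀ k → a * b ≡ s + k * N → ⊥
  split zero eq = n≮n (a * b) (begin-strict
    a * b        ≡⟨ trans eq (+-identityʳ s) ⟩
    s            <⟨ s<N ⟩
    N            ≤⟨ m≤n+m N Q ⟩
    Q + N        ≡⟨ eqQ ⟩
    a * b        ∎)
  split (suc k) eq with k ≤? c
  -- A quotient of at least `b` would give `a * b ≥ b * N = a * b + b * b`.
  ... | no k≰c = n≮n (a * b) (begin-strict
    a * b            <⟨ m<m+n (a * b) (subst (λ b → 0 < b * b) (sym b≡) (s≤s z≤n)) ⟩
    a * b + b * b    ≡⟨ *-distribʳ-+ b a b ⟨
    N * b            ≡⟨ *-comm N b ⟩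
    b * N            ≡⟨ cong (_* N) b≡ ⟩
    (2 + c) * N      ≤⟨ *-monoˡ-≤ N (s≤s (≰⇒> k≰c)) ⟩
    suc k * N        ≤⟨ m≤n+m _ s ⟩
    s + suc k * N    ≡⟨ eq ⟨
    a * b            ∎)
  ... | yes k≤c with suc k ≤? c
  ...   | yes k<c = n≮n (b * b + c) (begin-strict
    b * b + c        ≤⟨ bound′ ⟩
    1 + l            ≤⟨ s≤s (bound-length k eq) ⟩
    suc k + s        ≤⟨ +-monoˡ-≤ s k<c ⟩
    c + s            <⟨ +-monoʳ-< c s<N ⟩
    c + N            ≤⟨ +-monoʳ-≤ c N≤B ⟩
    c + b * b        ≡⟨ +-comm c (b * b) ⟩
    b * b + c        ∎)
  ...   | no k≮c with refl ← ≤-antisym k≤c (≤-pred (≰⇒> k≮c)) = n≮n (b * b + c) (begin-strict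
    b * b + c        ≤⟨ bound′ ⟩
    1 + l            ≤⟨ s≤s (bound-length k eq) ⟩
    suc (c + s)      ≤⟨ s≤s (+-monoʳ-≤ c s≤0) ⟩
    suc (c + 0)      ≡⟨ cong suc (+-identityʳ c) ⟩
    suc c            <⟨ +-monoˡ-≤ c (subst (λ b → 2 ≤ b * b) (sym b≡) (s≤s (s≤s z≤n))) ⟩
    b * b + c        ∎)
    where
    regroup : ∀ s N c → s + N * (2 + c) ≡ s + suc c * N + N
    regroup = solve-∀
    -- For quotient `b - 1`, the relations `N * b = a * b + b * b` and `N ≤ b * b` leave no room for
    -- a remainder.
    s≤0 : s ≤ 0
    s≤0 = +-cancelʳ-≤ (N * b) s 0 (begin
      s + N * b          ≡⟨ cong (λ b → s + N * b) b≡ ⟩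
      s + N * (2 + c)    ≡⟨ regroup s N c ⟩
      s + suc c * N + N  ≡⟨ cong (_+ N) eq ⟨
      a * b + N          ≤⟨ +-monoʳ-≤ (a * b) N≤B ⟩
      a * b + b * b      ≡⟨ *-distribʳ-+ b a b ⟨
      N * b              ∎)

-- The equations of an arithmetical structure along the path v₁, …, v_ℓ

path : ∀ {l} → Vec ℕ l → Fin l → ℕ
path rs i = sum (zipWith _*_ (tabulate (λ j → pathAdj (toℕ i) (toℕ j))) rs)

-- The default 0 is the final 0 of a `Chain`, so this is r₁ also when ℓ = 0.
headOr0 : ∀ {l} → Vec ℕ l → ℕ
headOr0 []      = 0
headOr0 (q ∷ _) = q

sum-zeros : ∀ {l} (rs : Vec ℕ l) → sum (zipWith _*_ (tabulate (λ _ → 0)) rs) ≡ 0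
sum-zeros []       = refl
sum-zeros (_ ∷ rs) = sum-zeros rs

pathAdj-suc : ∀ a c → pathAdj (suc a) (suc c) ≡ pathAdj a c
pathAdj-suc zero    c = refl
pathAdj-suc (suc a) c = refl

weighted-sum-cong : ∀ {l} {f g : Fin l → ℕ} (rs : Vec ℕ l) → (∀ j → f j ≡ g j) →
  sum (zipWith _*_ (tabulate f) rs) ≡ sum (zipWith _*_ (tabulate g) rs)
weighted-sum-cong []       f≗g = refl
weighted-sum-cong (r ∷ rs) f≗g =
  cong₂ _+_ (cong (_* r) (f≗g zero)) (weighted-sum-cong rs (λ j → f≗g (suc j)))

weighted-sum-scale : ∀ {l} k (as rs : Vec ℕ l) →
  sum (zipWith _*_ as (map (k *_) rs)) ≡ k * sum (zipWith _*_ as rs)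
weighted-sum-scale k []       []       = sym (*-zeroʳ k)
weighted-sum-scale k (a ∷ as) (r ∷ rs) =
  trans (cong (a * (k * r) +_) (weighted-sum-scale k as rs)) (regroup a k r _)
  where
  regroup : ∀ a k r x → a * (k * r) + k * x ≡ k * (a * r + x)
  regroup = solve-∀

end-row : ∀ {l} (rs : Vec ℕ l) → sum (zipWith _*_ (tabulate (λ j → pathAdj 0 (suc (toℕ j)))) rs) ≡ headOr0 rs
end-row []       = refl
end-row (q ∷ rs) = trans (cong₂ _+_ (+-identityʳ q) (sum-zeros rs)) (+-identityʳ q)

path-suc : ∀ {l} (q : ℕ) (rs : Vec ℕ l) i →
  path (q ∷ rs) (suc i) ≡ pathAdj (suc (toℕ i)) 0 * q + path rs i
path-suc q rs i = cong (pathAdj (suc (toℕ i)) 0 * q +_)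
  (weighted-sum-cong rs (λ j → pathAdj-suc (toℕ i) (toℕ j)))

-- pathAdj (suc (toℕ i)) 0 is 1 for i = 0 and 0 otherwise.
Rows : ∀ {l} → ℕ → Vec ℕ l → Vec ℕ l → Set
Rows p ds rs = ∀ i → lookup ds i * lookup rs i ≡ pathAdj (suc (toℕ i)) 0 * p + path rs i

-- Removing the first vertex of the path lets its value `q` take over the role of `p`.
rows⇒chain : ∀ {p l} (ds rs : Vec ℕ l) → 1 ≤ p → (∀ i → 2 ≤ lookup ds i) → (∀ i → 1 ≤ lookup rs i) →
  Rows p ds rs → Chain p (headOr0 rs) ds rs
rows⇒chain []       []       1≤p ds≥2 rs≥1 rows = end 1≤p
rows⇒chain {p} (d ∷ ds) (q ∷ rs) 1≤p ds≥2 rs≥1 rows =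
  step (ds≥2 zero) (trans (rows zero) (cong₂ _+_ (+-identityʳ p) (end-row rs)))
    (rows⇒chain ds rs (rs≥1 zero) (λ i → ds≥2 (suc i)) (λ i → rs≥1 (suc i))
      (λ i → trans (rows (suc i)) (path-suc q rs i)))

chain-head : ∀ {p q l} {ds rs : Vec ℕ l} → Chain p q ds rs → headOr0 rs ≡ q
chain-head (end _)      = refl
chain-head (step _ _ _) = refl

chain⇒rows : ∀ {p q l} {ds rs : Vec ℕ l} → Chain p q ds rs → Rows p ds rs
chain⇒rows {p} (step {rs = rs} _ eq ch) zero = trans eq (sym
  (cong₂ _+_ (+-identityʳ p) (trans (end-row rs) (chain-head ch))))
chain⇒rows (step {q = q} {rs = rs} _ eq ch) (suc i) = trans (chain⇒rows ch i) (sym (path-suc q rs i))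

chain⇒d≥2 : ∀ {p q l} {ds rs : Vec ℕ l} → Chain p q ds rs → ∀ i → 2 ≤ lookup ds i
chain⇒d≥2 (step 2≤d _ _) zero    = 2≤d
chain⇒d≥2 (step _ _ ch)  (suc i) = chain⇒d≥2 ch i

chain⇒r≥1 : ∀ {p q l} {ds rs : Vec ℕ l} → Chain p q ds rs → ∀ i → 1 ≤ lookup rs i
chain⇒r≥1 (step _ _ ch) zero    = ≤-trans (s≤s z≤n) (chain-< ch)
chain⇒r≥1 (step _ _ ch) (suc i) = chain⇒r≥1 ch i

module _ {l} (x y z : ℕ) (rs : Vec ℕ l) where
  Ar-x : Ar (3 + l) (x ∷ y ∷ z ∷ rs) zero ≡ z
  Ar-x = trans (cong₂ _+_ (+-identityʳ z) (sum-zeros rs)) (+-identityʳ z)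

  Ar-y : Ar (3 + l) (x ∷ y ∷ z ∷ rs) (suc zero) ≡ z
  Ar-y = Ar-x

  Ar-0 : Ar (3 + l) (x ∷ y ∷ z ∷ rs) (suc (suc zero)) ≡ x + (y + headOr0 rs)
  Ar-0 = cong₂ _+_ (+-identityʳ x) (cong₂ _+_ (+-identityʳ y) (end-row rs))

  Ar-path : ∀ i → Ar (3 + l) (x ∷ y ∷ z ∷ rs) (suc (suc (suc i))) ≡ pathAdj (suc (toℕ i)) 0 * z + path rs i
  Ar-path i = path-suc z rs i

-- Primitive vectors

gcds : ∀ {n} → Vec ℕ n → ℕ
gcds = foldr′ gcd 0

gcds-∣ : ∀ {n} (r : Vec ℕ n) i → gcds r ∣ lookup r i
gcds-∣ (x ∷ r) zero    = gcd[m,n]∣m x (gcds r)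
gcds-∣ (x ∷ r) (suc i) = ∣-trans (gcd[m,n]∣n x (gcds r)) (gcds-∣ r i)

gcds-greatest : ∀ {n k} (r : Vec ℕ n) → (∀ i → k ∣ lookup r i) → k ∣ gcds r
gcds-greatest []      k∣r = _ ∣0
gcds-greatest (x ∷ r) k∣r = gcd-greatest (k∣r zero) (gcds-greatest r (λ i → k∣r (suc i)))

divide-out : ∀ {n} k (r : Vec ℕ n) → (∀ i → k ∣ lookup r i) → ∃ λ r′ → r ≡ map (k *_) r′
divide-out k []      k∣r = [] , refl
divide-out k (x ∷ r) k∣r with k∣r zero | divide-out k r (λ i → k∣r (suc i))
... | divides q eq | r′ , eq′ = q ∷ r′ , cong₂ _∷_ (trans eq (*-comm q k)) eq′

-- If `k` divides all of `r′`, then `g * k` divides all of `r`, hence divides the gcd `g`, so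
-- `k = 1`.
primitive-part : ∀ {n} (r : Vec ℕ (suc n)) → (∀ i → 1 ≤ lookup r i) →
  ∃₂ λ g r′ → 1 ≤ g × r ≡ map (g *_) r′ × Primitive (suc n) r′
primitive-part r r≥1 with divide-out (gcds r) r (gcds-∣ r)
... | r′ , eq = g , r′ , 1≤g , eq , prim
  where
  g = gcds r
  1≤g : 1 ≤ g
  1≤g = n≢0⇒n>0 λ g≡0 → n≮n 0 (subst (1 ≤_) (0∣⇒≡0 (subst (_∣ lookup r zero) g≡0 (gcds-∣ r zero))) (r≥1 zero))
  prim : Primitive _ r′
  prim k k∣r′ = ∣1⇒≡1 (*-cancelˡ-∣ g {{>-nonZero 1≤g}} (subst (g * k ∣_) (sym (*-identityʳ g))
    (gcds-greatest r λ i → subst (g * k ∣_)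
      (sym (trans (cong (λ r → lookup r i) eq) (lookup-map i (g *_) r′)))
      (*-monoʳ-∣ g (k∣r′ i)))))

gcds-scale : ∀ {n} k (r : Vec ℕ n) → gcds (map (k *_) r) ≡ k * gcds r
gcds-scale k []      = sym (*-zeroʳ k)
gcds-scale k (x ∷ r) = trans (cong (gcd (k * x)) (gcds-scale k r)) (sym (c*gcd[m,n]≡gcd[cm,cn] k x (gcds r)))

primitive-scale-gcds : ∀ {n} k (r : Vec ℕ n) → Primitive n r → gcds (map (k *_) r) ≡ k
primitive-scale-gcds k r prim =
  trans (gcds-scale k r) (trans (cong (k *_) (prim (gcds r) (gcds-∣ r))) (*-identityʳ k))

map-*-injective : ∀ {n} k {r r′ : Vec ℕ n} → 1 ≤ k → map (k *_) r ≡ map (k *_) r′ → r ≡ r′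
map-*-injective k {[]}    {[]}     1≤k eq = refl
map-*-injective k {x ∷ r} {y ∷ r′} 1≤k eq =
  cong₂ _∷_ (*-cancelˡ-≡ x y k {{>-nonZero 1≤k}} (cong (λ v → at v 0) eq))
            (map-*-injective k 1≤k (cong tail eq))

-- The gcd of `k` times a primitive vector is `k`; comparing gcds gives `k = k′`, which then
-- cancels.
primitive-unique : ∀ {n} k k′ {r r′ : Vec ℕ n} → 1 ≤ k → Primitive n r → Primitive n r′ →
  map (k *_) r ≡ map (k′ *_) r′ → r ≡ r′
primitive-unique k k′ {r} {r′} 1≤k prim prim′ eq
  with refl ← trans (sym (primitive-scale-gcds k r prim)) (trans (cong gcds eq) (primitive-scale-gcds k′ r′ prim′))
  = map-*-injective k 1≤k eq

-- Smooth structures with d_x = b and d_y = a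

-- Equivalent to `(a - 1) * (b - 1) ≥ 1`; it makes the truncated difference `a * b ∸ (a + b)` exact.
a+b≤a*b : ∀ {a b} → 2 ≤ a → 2 ≤ b → a + b ≤ a * b
a+b≤a*b {suc (suc a)} {suc (suc b)} _ _ = ≤-trans (m≤m+n _ _) (≤-reflexive (identity a b))
  where
  identity : ∀ a b → (2 + a) + (2 + b) + (a + b + a * b) ≡ (2 + a) * (2 + b)
  identity = solve-∀
a+b≤a*b {suc zero} (s≤s ()) _
a+b≤a*b {suc (suc _)} {suc zero} _ (s≤s ())

unscaled-≥1 : ∀ {a b Q l} {ds rs : Vec ℕ l} → 2 ≤ a → 2 ≤ b → Chain (a * b) Q ds rs →
  ∀ i → 1 ≤ lookup (a ∷ b ∷ a * b ∷ rs) i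
unscaled-≥1 2≤a 2≤b ch zero                = <⇒≤ 2≤a
unscaled-≥1 2≤a 2≤b ch (suc zero)          = <⇒≤ 2≤b
unscaled-≥1 2≤a 2≤b ch (suc (suc zero))    = *-mono-≤ (<⇒≤ 2≤a) (<⇒≤ 2≤b)
unscaled-≥1 2≤a 2≤b ch (suc (suc (suc i))) = chain⇒r≥1 ch i

-- The vector `R` with r₀ = `a * b`, r_x = `a`, r_y = `b` solves the equations; at v₀, where d₀ = 1,
-- the equation is `eqQ`. By homogeneity they pass to the primitive `r` after cancelling `g`.
module Normalise {a b Q l : ℕ} {ds rs : Vec ℕ l} (2≤a : 2 ≤ a) (2≤b : 2 ≤ b) (eqQ : Q + (a + b) ≡ a * b)
  (ch : Chain (a * b) Q ds rs) (g : ℕ) (1≤g : 1 ≤ g) (r : Vec ℕ (3 + l))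
  (R≡ : a ∷ b ∷ a * b ∷ rs ≡ map (g *_) r) where
  open ≡-Reasoning
  instance
    g≢0 : NonZero g
    g≢0 = >-nonZero 1≤g
  R d : Vec ℕ (3 + l)
  R = a ∷ b ∷ a * b ∷ rs
  d = b ∷ a ∷ 1 ∷ ds
  R-entry : ∀ i → lookup R i ≡ g * lookup r i
  R-entry i = trans (cong (λ v → lookup v i) R≡) (lookup-map i (g *_) r)
  R-equations : ∀ i → lookup d i * lookup R i ≡ Ar (3 + l) R i
  R-equations zero                = trans (*-comm b a) (sym (Ar-x a b (a * b) rs))
  R-equations (suc zero)          = sym (Ar-y a b (a * b) rs)
  R-equations (suc (suc zero))    = begin
    1 * (a * b)            ≡⟨ *-identityˡ (a * b) ⟩
    a * b                  ≡⟨ eqQ ⟨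
    Q + (a + b)            ≡⟨ +-comm Q (a + b) ⟩
    a + b + Q              ≡⟨ +-assoc a b Q ⟩
    a + (b + Q)            ≡⟨ cong (λ q → a + (b + q)) (chain-head ch) ⟨
    a + (b + headOr0 rs)   ≡⟨ Ar-0 a b (a * b) rs ⟨
    Ar (3 + l) R (suc (suc zero)) ∎
  R-equations (suc (suc (suc i))) = trans (chain⇒rows ch i) (sym (Ar-path a b (a * b) rs i))
  swap : ∀ g d x → g * (d * x) ≡ d * (g * x)
  swap = solve-∀
  equations : ∀ i → lookup d i * lookup r i ≡ Ar (3 + l) r i
  equations i = *-cancelˡ-≡ _ _ g (begin
    g * (lookup d i * lookup r i)  ≡⟨ swap g (lookup d i) (lookup r i) ⟩
    lookup d i * (g * lookup r i)  ≡⟨ cong (lookup d i *_) (R-entry i) ⟨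
    lookup d i * lookup R i        ≡⟨ R-equations i ⟩
    Ar (3 + l) R i                 ≡⟨ cong (λ v → Ar (3 + l) v i) R≡ ⟩
    Ar (3 + l) (map (g *_) r) i    ≡⟨ weighted-sum-scale g (tabulate (A (3 + l) i)) r ⟩
    g * Ar (3 + l) r i             ∎)
  smooth : ∀ i → toℕ i ≢ 2 → 2 ≤ lookup d i
  smooth zero                _   = 2≤b
  smooth (suc zero)          _   = 2≤a
  smooth (suc (suc zero))    i≢2 = contradiction refl i≢2
  smooth (suc (suc (suc i))) _   = chain⇒d≥2 ch i
  d≥1 : ∀ i → 1 ≤ lookup d i
  d≥1 zero                = <⇒≤ 2≤b
  d≥1 (suc zero)          = <⇒≤ 2≤a
  d≥1 (suc (suc zero))    = ≤-refl
  d≥1 (suc (suc (suc i))) = <⇒≤ (chain⇒d≥2 ch i)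
  r≥1 : ∀ i → 1 ≤ lookup r i
  r≥1 i = n≢0⇒n>0 λ r≡0 → n≮n 0 (subst (1 ≤_)
    (trans (R-entry i) (trans (cong (g *_) r≡0) (*-zeroʳ g))) (unscaled-≥1 2≤a 2≤b ch i))

-- By definition r̄_y is r₀ / r_x, and the equation at v_x identifies this with d_x.
r̄-y≡d-x : ∀ b {l} (r : Vec ℕ (3 + l)) → b * lookup r zero ≡ Ar (3 + l) r zero →
  at r 2 * at r 1 ≡ b * (at r 0 * at r 1)
r̄-y≡d-x b (x ∷ y ∷ z ∷ rs) eq = trans (cong (_* y) (sym (trans eq (Ar-x x y z rs)))) (*-assoc b x y)

chain⇒structure : ∀ {a b Q l} {ds rs : Vec ℕ l} → 2 ≤ a → 2 ≤ b → Q + (a + b) ≡ a * b →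
  Chain (a * b) Q ds rs →
  ∃₂ λ g r → 1 ≤ g × a ∷ b ∷ a * b ∷ rs ≡ map (g *_) r × Counted (3 + l) b (b ∷ a ∷ 1 ∷ ds , r)
chain⇒structure {b = b} 2≤a 2≤b eqQ ch =
  let g , r , 1≤g , R≡ , prim = primitive-part _ (unscaled-≥1 2≤a 2≤b ch)
      module N = Normalise 2≤a 2≤b eqQ ch g 1≤g r R≡
  in g , r , 1≤g , R≡ , (N.d≥1 , N.r≥1 , N.equations , prim) , N.smooth , r̄-y≡d-x b r (N.equations zero)

-- Recovering the chain from a counted structure

module Decode {b l dx a d₀ x y z : ℕ} {ds rs : Vec ℕ l} (2≤b : 2 ≤ b)
              (counted : Counted (3 + l) b (dx ∷ a ∷ d₀ ∷ ds , x ∷ y ∷ z ∷ rs)) where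
  private
    d≥1       = proj₁ (proj₁ counted)
    r≥1       = proj₁ (proj₂ (proj₁ counted))
    equations = proj₁ (proj₂ (proj₂ (proj₁ counted)))
    smooth    = proj₁ (proj₂ counted)
    r̄-y       = proj₂ (proj₂ counted)

  r-primitive : Primitive (3 + l) (x ∷ y ∷ z ∷ rs)
  r-primitive = proj₂ (proj₂ (proj₂ (proj₁ counted)))

  2≤a : 2 ≤ a
  2≤a = smooth (suc zero) λ ()

  1≤z : 1 ≤ z
  1≤z = r≥1 (suc (suc zero))

  dx*x≡z : dx * x ≡ z
  dx*x≡z = trans (equations zero) (Ar-x x y z rs)

  a*y≡z : a * y ≡ z
  a*y≡z = trans (equations (suc zero)) (Ar-y x y z rs)

  b*x≡z : b * x ≡ z
  b*x≡z = *-cancelʳ-≡ (b * x) z y {{>-nonZero (r≥1 (suc zero))}} (trans (*-assoc b x y) (sym r̄-y))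

  dx≡b : dx ≡ b
  dx≡b = *-cancelʳ-≡ dx b x {{>-nonZero (r≥1 zero)}} (trans dx*x≡z (sym b*x≡z))

  chain : Chain z (headOr0 rs) ds rs
  chain = rows⇒chain ds rs 1≤z (λ i → smooth (suc (suc (suc i))) λ ()) (λ i → r≥1 (suc (suc (suc i))))
    (λ i → trans (equations (suc (suc (suc i)))) (Ar-path x y z rs i))

  -- r_x and r_y are at most r₀ / 2 and r₁ < r₀, so d₀ r₀ < 2 r₀.
  d₀≡1 : d₀ ≡ 1
  d₀≡1 = ≤-antisym (≤-pred (*-cancelʳ-< z d₀ 2 (*-cancelˡ-< 2 _ _ (begin-strict
    2 * (d₀ * z)                       ≡⟨ cong (2 *_) (trans (equations (suc (suc zero))) (Ar-0 x y z rs)) ⟩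
    2 * (x + (y + headOr0 rs))         ≡⟨ expand x y (headOr0 rs) ⟩
    2 * x + 2 * y + 2 * headOr0 rs     <⟨ +-mono-≤-< (+-mono-≤ (*-monoˡ-≤ x 2≤b) (*-monoˡ-≤ y 2≤a))
                                                      (*-monoʳ-< 2 (chain-< chain)) ⟩
    b * x + a * y + 2 * z              ≡⟨ cong₂ (λ u v → u + v + 2 * z) b*x≡z a*y≡z ⟩
    z + z + 2 * z                      ≡⟨ collect z ⟩
    2 * (2 * z)                        ∎)))) (d≥1 (suc (suc zero)))
    where
    open ≤-Reasoning
    expand : ∀ x y q → 2 * (x + (y + q)) ≡ 2 * x + 2 * y + 2 * q
    expand = solve-∀
    collect : ∀ z → z + z + 2 * z ≡ 2 * (2 * z)
    collect = solve-∀

  -- The equation at v₀, multiplied by `a * b`: in cross-multiplied form, r₁ / r₀ = `Q / (a * b)`.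
  ratio : ∀ {Q} → Q + (a + b) ≡ a * b → a * b * headOr0 rs ≡ z * Q
  ratio {Q} eqQ = +-cancelʳ-≡ (z * (a + b)) _ _ (begin
    a * b * q + z * (a + b)                    ≡⟨ cong (a * b * q +_) (*-distribˡ-+ z a b) ⟩
    a * b * q + (z * a + z * b)                ≡⟨ cong₂ (λ u v → a * b * q + (u * a + v * b)) b*x≡z a*y≡z ⟨
    a * b * q + (b * x * a + a * y * b)        ≡⟨ collect a b x y q ⟩
    a * b * (x + (y + q))                      ≡⟨ cong (a * b *_) (trans (equations (suc (suc zero))) (Ar-0 x y z rs)) ⟨
    a * b * (d₀ * z)                           ≡⟨ cong (λ d → a * b * (d * z)) d₀≡1 ⟩
    a * b * (1 * z)                            ≡⟨ cong (a * b *_) (*-identityˡ z) ⟩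
    a * b * z                                  ≡⟨ *-comm (a * b) z ⟩
    z * (a * b)                                ≡⟨ cong (z *_) eqQ ⟨
    z * (Q + (a + b))                          ≡⟨ *-distribˡ-+ z Q (a + b) ⟩
    z * Q + z * (a + b)                        ∎)
    where
    open ≡-Reasoning
    q = headOr0 rs
    collect : ∀ a b x y q → a * b * q + (b * x * a + a * y * b) ≡ a * b * (x + (y + q))
    collect = solve-∀

  -- Scaled by `a * b` and by `z` respectively, both chains start with the same two numbers, so
  -- `chain-unique` applies and also yields `l ≡ l′`.
  proportional : ∀ {Q l′} {ds′ rs′ : Vec ℕ l′} → Q + (a + b) ≡ a * b → Chain (a * b) Q ds′ rs′ →
    _≡_ {A = Σ ℕ λ l → Vec ℕ l × Vec ℕ l} (l , ds , map (a * b *_) rs) (l′ , ds′ , map (z *_) rs′)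
  proportional {Q} eqQ ch = chain-unique
    (chain-cong (*-comm (a * b) z) (ratio eqQ)
      (chain-scale (a * b) (*-mono-≤ (<⇒≤ 2≤a) (<⇒≤ 2≤b)) chain))
    (chain-scale z 1≤z ch)

  has-length : ∀ {Q} → Q + (a + b) ≡ a * b → HasLength (a * b) Q l
  has-length {Q} eqQ with chain-exists Q (a * b) (subst (Q <_) eqQ (m<m+n Q (≤-trans (<⇒≤ 2≤a) (m≤m+n a b))))
  ... | l′ , _ , ds′ , rs′ , ch with refl ← cong proj₁ (proportional eqQ ch) = ds′ , rs′ , ch

-- `proportional` fixes `ds`. It also makes `r` and `r′` proportional, with factors `a * b` and
-- `z * g`, and both are primitive.
structure-unique : ∀ {a b Q l dx dy d₀ x y z g} {ds rs ds′ rs′ : Vec ℕ l} {r′ : Vec ℕ (3 + l)} → 2 ≤ b →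
  dy ≡ a → Q + (a + b) ≡ a * b → Chain (a * b) Q ds′ rs′ →
  1 ≤ g → a ∷ b ∷ a * b ∷ rs′ ≡ map (g *_) r′ → Primitive (3 + l) r′ →
  Counted (3 + l) b (dx ∷ dy ∷ d₀ ∷ ds , x ∷ y ∷ z ∷ rs) →
  (dx ∷ dy ∷ d₀ ∷ ds , x ∷ y ∷ z ∷ rs) ≡ (b ∷ a ∷ 1 ∷ ds′ , r′)
structure-unique {a} {b} {Q} {l} {dx} {dy} {d₀} {x} {y} {z} {g} {ds} {rs} {ds′} {rs′} {r′}
  2≤b refl eqQ ch 1≤g R≡ prim′ counted with proportional eqQ ch
  where open Decode 2≤b counted
... | eq = cong₂ _,_ d-eq r-eq
  where
  open Decode 2≤b counted
  open ≡-Reasoning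
  components : ∀ {l} {u u′ v v′ : Vec ℕ l} →
    _≡_ {A = Σ ℕ λ l → Vec ℕ l × Vec ℕ l} (l , u , v) (l , u′ , v′) → u ≡ u′ × v ≡ v′
  components refl = refl , refl
  d-eq : dx ∷ a ∷ d₀ ∷ ds ≡ b ∷ a ∷ 1 ∷ ds′
  d-eq with refl ← proj₁ (components eq) = cong₂ (λ u v → u ∷ a ∷ v ∷ ds) dx≡b d₀≡1
  swap-x : ∀ a b x → a * b * x ≡ b * x * a
  swap-x = solve-∀
  swap-y : ∀ a b y → a * b * y ≡ a * y * b
  swap-y = solve-∀
  scaled : map (a * b *_) (x ∷ y ∷ z ∷ rs) ≡ map (z * g *_) r′
  scaled = begin
    map (a * b *_) (x ∷ y ∷ z ∷ rs)
      ≡⟨ cong₂ _∷_ (trans (swap-x a b x) (cong (_* a) b*x≡z))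
        (cong₂ _∷_ (trans (swap-y a b y) (cong (_* b) a*y≡z))
        (cong₂ _∷_ (*-comm (a * b) z) (proj₂ (components eq)))) ⟩
    map (z *_) (a ∷ b ∷ a * b ∷ rs′)  ≡⟨ cong (map (z *_)) R≡ ⟩
    map (z *_) (map (g *_) r′)        ≡⟨ map-∘ (z *_) (g *_) r′ ⟨
    map (λ u → z * (g * u)) r′        ≡⟨ map-cong (λ u → *-assoc z g u) r′ ⟨
    map (z * g *_) r′                 ∎
  r-eq : x ∷ y ∷ z ∷ rs ≡ r′
  r-eq = primitive-unique (a * b) (z * g) (*-mono-≤ (<⇒≤ 2≤a) (<⇒≤ 2≤b)) r-primitive prim′ scaled

-- The b² structures, indexed by the residue of a + b modulo b²

module Enumeration (b l : ℕ) (2≤b : 2 ≤ b) (bound : b * b + b ≤ 3 + l) where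
  B c : ℕ
  B = b * b
  c = b ∸ 2

  b≡2+c : b ≡ 2 + c
  b≡2+c = sym (m+[n∸m]≡n 2≤b)

  2≤B : 2 ≤ B
  2≤B = ≤-trans (m≤m+n 2 2) (*-mono-≤ 2≤b 2≤b)

  instance
    b≢0 : NonZero b
    b≢0 = >-nonZero (<⇒≤ 2≤b)
    B≢0 : NonZero B
    B≢0 = >-nonZero (<⇒≤ 2≤B)

  -- The index `i` stands for j = `suc (toℕ i)`, which runs from 1 to b². The number `m i` is chosen
  -- so that the length `c + (m i + h i)` is `l`, and `a i` solves `a + b = j + (m + 1) * B`.
  h m a Q : Fin B → ℕ
  h i = proj₁ (residue-chain B i 2≤B)
  m i = l ∸ (c + h i)
  a i = suc (toℕ i) + suc (m i) * B ∸ b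
  Q i = a i * b ∸ (a i + b)

  a+b≡ : ∀ i → a i + b ≡ suc (toℕ i) + suc (m i) * B
  a+b≡ i = m∸n+n≡m (≤-trans (m≤m*n b b) (≤-trans (m≤m+n B (m i * B)) (m≤n+m _ (suc (toℕ i)))))

  2≤a : ∀ i → 2 ≤ a i
  2≤a i = +-cancelʳ-≤ b 2 (a i) (begin
    2 + b                          ≤⟨ +-monoˡ-≤ b 2≤b ⟩
    b + b                          ≡⟨ cong (b +_) (+-identityʳ b) ⟨
    2 * b                          ≤⟨ *-monoˡ-≤ b 2≤b ⟩
    B                              ≤⟨ m≤m+n B (m i * B) ⟩
    suc (m i) * B                  ≤⟨ m≤n+m _ (suc (toℕ i)) ⟩
    suc (toℕ i) + suc (m i) * B    ≡⟨ a+b≡ i ⟨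
    a i + b                        ∎)
    where open ≤-Reasoning

  Q≡ : ∀ i → Q i + (a i + b) ≡ a i * b
  Q≡ i = m∸n+n≡m (a+b≤a*b (2≤a i) 2≤b)

  rearrange : ∀ c m h → c + (m + h) ≡ m + (c + h)
  rearrange = solve-∀

  -- The strict inequality `h i < B` together with `bound` makes the subtraction defining `m i`
  -- exact.
  c+h≤l : ∀ i → c + h i ≤ l
  c+h≤l i = +-cancelˡ-≤ 3 _ _ (begin
    3 + (c + h i)          ≡⟨ regroup c (h i) ⟩
    suc (h i) + (2 + c)    ≡⟨ cong (suc (h i) +_) b≡2+c ⟨
    suc (h i) + b          ≤⟨ +-monoˡ-≤ b (proj₁ (proj₂ (residue-chain B i 2≤B))) ⟩
    B + b                  ≤⟨ bound ⟩
    3 + l                  ∎)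
    where
    open ≤-Reasoning
    regroup : ∀ c h → 3 + (c + h) ≡ suc h + (2 + c)
    regroup = solve-∀

  abstract
    long : ∀ i → HasLength (a i * b) (Q i) l
    long i = subst (HasLength _ _) (trans (rearrange c (m i) (h i)) (m∸n+n≡m (c+h≤l i)))
      (long-chain {b} {c} {a i} {toℕ i} {m i} b≡2+c (a+b≡ i) (Q≡ i) (proj₂ (proj₂ (residue-chain B i 2≤B))))

    built : ∀ i → ∃₂ λ g r → 1 ≤ g × a i ∷ b ∷ a i * b ∷ proj₁ (proj₂ (long i)) ≡ map (g *_) r ×
                             Counted (3 + l) b (b ∷ a i ∷ 1 ∷ proj₁ (long i) , r)
    built i = chain⇒structure (2≤a i) 2≤b (Q≡ i) (proj₂ (proj₂ (long i)))

  structure : Fin B → Vec ℕ (3 + l) × Vec ℕ (3 + l)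
  structure i = b ∷ a i ∷ 1 ∷ proj₁ (long i) , proj₁ (proj₂ (built i))

  structure-counted : ∀ i → Counted (3 + l) b (structure i)
  structure-counted i = proj₂ (proj₂ (proj₂ (proj₂ (built i))))

  residue : ∀ (i : Fin B) k → (toℕ i + k * B) % B ≡ toℕ i
  residue i k = trans ([m+kn]%n≡m%n (toℕ i) k B) (m<n⇒m%n≡m (toℕ<n i))

  -- The entry d_y is `a i`, and `toℕ i` is the residue of `a i + b - 1` modulo `B`.
  structure-injective : ∀ {i j} → structure i ≡ structure j → i ≡ j
  structure-injective {i} {j} eq = toℕ-injective (begin
    toℕ i                           ≡⟨ residue i (suc (m i)) ⟨
    (toℕ i + suc (m i) * B) % B     ≡⟨ cong (_% B) N≡ ⟩
    (toℕ j + suc (m j) * B) % B     ≡⟨ residue j (suc (m j)) ⟩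
    toℕ j                           ∎)
    where
    open ≡-Reasoning
    a≡ : a i ≡ a j
    a≡ = cong (λ s → at (proj₁ s) 1) eq
    N≡ : toℕ i + suc (m i) * B ≡ toℕ j + suc (m j) * B
    N≡ = suc-injective (trans (sym (a+b≡ i)) (trans (cong (_+ b) a≡) (a+b≡ j)))

  -- Sums `a′ + b` up to `B` are excluded by `short-chain`. For larger ones the residue gives `i`,
  -- and uniqueness of the length forces the quotient `k` to be `m i`.
  classify : ∀ a′ Q′ → 2 ≤ a′ → Q′ + (a′ + b) ≡ a′ * b → HasLength (a′ * b) Q′ l → ∃ λ i → a′ ≡ a i
  classify a′ Q′ 2≤a′ eqQ hl with a′ + b ≤? B
  ... | yes N≤B = ⊥-elim (short-chain {b} {c} b≡2+c 2≤a′ N≤B bound eqQ hl)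
  ... | no N≰B = i , +-cancelʳ-≡ b a′ (a i) (trans N≡ (sym (trans (a+b≡ i) (cong (λ k → suc (toℕ i) + suc k * B) m≡))))
    where
    open ≡-Reasoning
    t k : ℕ
    -- Subtracting `suc B` instead of `B` makes j range over 1, ..., `B` rather than 0, ...,
    -- `B - 1`.
    t = a′ + b ∸ suc B
    k = t / B
    i : Fin B
    i = fromℕ< (m%n<n t B)
    N≡ : a′ + b ≡ suc (toℕ i) + suc k * B
    N≡ = begin
      a′ + b                       ≡⟨ m∸n+n≡m (≰⇒> N≰B) ⟨
      t + suc B                    ≡⟨ cong (_+ suc B) (m≡m%n+[m/n]*n t B) ⟩
      t % B + k * B + suc B        ≡⟨ cong (λ s → s + k * B + suc B) (toℕ-fromℕ< (m%n<n t B)) ⟨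
      toℕ i + k * B + suc B        ≡⟨ regroup (toℕ i) (k * B) B ⟩
      suc (toℕ i) + suc k * B      ∎
      where
      regroup : ∀ i x B → i + x + suc B ≡ suc i + (B + x)
      regroup = solve-∀
    long′ : HasLength (a′ * b) Q′ (c + (k + h i))
    long′ = long-chain {b} {c} {a′} {toℕ i} {k} b≡2+c N≡ eqQ (proj₂ (proj₂ (residue-chain B i 2≤B)))
    m≡ : m i ≡ k
    m≡ = begin
      l ∸ (c + h i)                ≡⟨ cong (_∸ (c + h i)) (length-unique hl long′) ⟩
      c + (k + h i) ∸ (c + h i)    ≡⟨ cong (_∸ (c + h i)) (rearrange c k (h i)) ⟩
      k + (c + h i) ∸ (c + h i)    ≡⟨ m+n∸n≡m k (c + h i) ⟩
      k                            ∎

  structure-determined : ∀ {dx dy d₀ x y z} {ds rs : Vec ℕ l} i → dy ≡ a i →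
    Counted (3 + l) b (dx ∷ dy ∷ d₀ ∷ ds , x ∷ y ∷ z ∷ rs) →
    (dx ∷ dy ∷ d₀ ∷ ds , x ∷ y ∷ z ∷ rs) ≡ structure i
  structure-determined i dy≡ counted =
    let _ , r , 1≤g , R≡ , (_ , _ , _ , prim) , _ = built i
    in structure-unique {r′ = r} 2≤b dy≡ (Q≡ i) (proj₂ (proj₂ (long i))) 1≤g R≡ prim counted

  structure-complete : ∀ s → Counted (3 + l) b s → ∃ λ i → s ≡ structure i
  structure-complete (dx ∷ dy ∷ d₀ ∷ ds , x ∷ y ∷ z ∷ rs) counted =
    let i , dy≡ = classify dy (dy * b ∸ (dy + b)) D.2≤a eqQ (D.has-length eqQ)
    in i , structure-determined i dy≡ counted
    where
    module D = Decode 2≤b counted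
    eqQ : dy * b ∸ (dy + b) + (dy + b) ≡ dy * b
    eqQ = m∸n+n≡m (a+b≤a*b D.2≤a 2≤b)

  count : ExactlyCounted (3 + l) b (b * b)
  count = List.map structure (allFin B)
        , trans (length-map structure (allFin B)) (length-tabulate {n = B} id)
        , Unique.map⁺ structure-injective (Unique.allFin⁺ B)
        , All.map⁺ (All.tabulate (λ {i} _ → structure-counted i))
        , complete
    where
    complete : ∀ s → Counted (3 + l) b s → s ∈ List.map structure (allFin B)
    complete s counted =
      let i , s≡ = structure-complete s counted
      in subst (_∈ List.map structure (allFin B)) (sym s≡) (∈-map⁺ structure (∈-allFin i))

6≤b*b+b : ∀ {b} → 2 ≤ b → 6 ≤ b * b + b
6≤b*b+b 2≤b = +-mono-≤ (*-mono-≤ 2≤b 2≤b) 2≤b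

theorem3p5 : (b n : ℕ) → 2 ≤ b → b * b + b ≤ n → ExactlyCounted n b (b * b)
theorem3p5 b n 2≤b bound
  -- The bound gives n ≥ 6, so n can be written as 3 + ℓ.
  with l , refl ← m≤n⇒∃[o]m+o≡n (≤-trans (m≤m+n 3 3) (≤-trans (6≤b*b+b 2≤b) bound))
  = Enumeration.count b l 2≤b bound
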